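{- Let $m_1$ be a positive even integer and let $m_2 \geq 1$ be an integer. The $m_1 \times m_2$ rook graph $K_{m_1} \square K_{m_2}$ does not have the PH-property if and only if $m_1 = 2$ and $m_2$ is odd.
   Context: All graphs are finite and simple (no loops or multiple edges); in particular a cycle has at least three vertices. $K_m$ denotes the complete graph on $m$ vertices. The Cartesian product $G \square H$ of two graphs $G$ and $H$ is the graph with vertex set $V(G)\times V(H)$ in which $(u_i,v_j)$ and $(u_k,v_l)$ are adjacent precisely if $u_i=u_k$ and $v_jv_l\in E(H)$, or $u_iu_k\in E(G)$ and $v_j=v_l$. The $m_1\times m_2$ rook graph has as vertices the cells of an $m_1\times m_2$ chessboard, two distinct cells being adjacent when they lie in the same row or in the same column; it is (isomorphic to) $K_{m_1}\square K_{m_2}$. For a graph $G$, let $K_G$ denote the complete graph on the vertex set $V(G)$. A perfect matching of a graph is a set of edges such that every vertex belongs to exactly one of them. A Hamiltonian cycle of a graph is a cycle of it visiting every vertex. For a graph $G$ of even order, a pairing of $G$ is a perfect matching of $K_G$ (its edges need not be edges of $G$). A graph $G$ of even order has the Pairing-Hamiltonian property (PH-property) if for every pairing $M$ of $G$ there exists a Hamiltonian cycle $H$ of $K_G$ with $M\subseteq E(H)$ and $E(H)-M\subseteq E(G)$. -}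

module Defs where

open import Data.Fin.Base using (Fin; toℕ)
import Data.Fin.Properties as Fin
open import Data.Nat.Base using (ℕ; suc; _*_; _≤_)
open import Data.Nat.DivMod using (_mod_)
open import Data.Nat.Divisibility using (_∣_)
open import Data.Product.Base using (Σ-syntax; ∃; _×_; _,_)
open import Data.Product using (∃!)
open import Data.Product.Function.NonDependent.Propositional using (_×-↔_)
open import Data.Sum.Base using (_⊎_; inj₁; inj₂)
open import Function.Bundles using (_↔_)
open import Function.Construct.Composition using (_↔-∘_)
open import Function.Construct.Identity using (↔-id)
open import Function.Construct.Symmetry using (↔-sym)
open import Function.Definitions using (Injective; Surjective)
open import Function.Properties.Inverse using (↔⇒↣)
open import Level using (0ℓ)
open import Relation.Binary.Construct.Closure.Symmetric using (SymClosure)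
open import Relation.Binary.Core using (Rel; _⇒_)
open import Relation.Binary.Definitions
  using (Symmetric; Irreflexive; Decidable; DecidableEquality)
open import Relation.Binary.PropositionalEquality
  using (_≡_; _≢_; refl; sym; ≢-sym)
open import Relation.Nullary using (¬_)
open import Relation.Nullary.Decidable using (via-injection; ¬?; _×-dec_; _⊎-dec_)

record Graph : Set₁ where
  infix 4 _~_ _~?_ _≟_
  field
    Vertex   : Set
    order    : ℕ
    finite   : Vertex ↔ Fin order
    _~_      : Rel Vertex 0ℓ
    _~?_     : Decidable _~_
    ~-sym    : Symmetric _~_
    ~-irrefl : Irreflexive _≡_ _~_

  _≟_ : DecidableEquality Vertex
  _≟_ = via-injection (↔⇒↣ finite) Fin._≟_

open Graph using (Vertex)

completeGraph : (V : Set) (n : ℕ) → V ↔ Fin n → Graph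
completeGraph V n V↔Fin = record
  { Vertex   = V
  ; order    = n
  ; finite   = V↔Fin
  ; _~_      = _≢_
  ; _~?_     = λ u v → ¬? (via-injection (↔⇒↣ V↔Fin) Fin._≟_ u v)
  ; ~-sym    = ≢-sym
  ; ~-irrefl = λ u≡v u≢v → u≢v u≡v
  }

K : ℕ → Graph
K m = completeGraph (Fin m) m (↔-id (Fin m))

-- The complete graph K_G on the vertex set of G.
K⟨_⟩ : Graph → Graph
K⟨ G ⟩ = completeGraph (Vertex G) order finite
  where open Graph G using (order; finite)

infixr 7 _□_

_□_ : Graph → Graph → Graph
G □ H = record
  { Vertex   = G.Vertex × H.Vertex
  ; order    = G.order * H.order
  ; finite   = ↔-sym (Fin.*↔× {G.order} {H.order}) ↔-∘ (G.finite ×-↔ H.finite)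
  ; _~_      = λ (a , b) (c , d) → (a ≡ c × b H.~ d) ⊎ (a G.~ c × b ≡ d)
  ; _~?_     = λ (a , b) (c , d) →
                 ((a G.≟ c) ×-dec (b H.~? d)) ⊎-dec ((a G.~? c) ×-dec (b H.≟ d))
  ; ~-sym    = λ { (inj₁ (p , q)) → inj₁ (sym p , H.~-sym q)
                 ; (inj₂ (p , q)) → inj₂ (G.~-sym p , sym q) }
  ; ~-irrefl = λ { refl (inj₁ (_ , q)) → H.~-irrefl refl q
                 ; refl (inj₂ (p , _)) → G.~-irrefl refl p }
  }
  where
  module G = Graph G
  module H = Graph H

-- Sets of edges are symmetric relations on the vertices contained in the
-- adjacency relation: `Edge u v` says that the edge uv belongs to the set.
record PerfectMatching (G : Graph) : Set₁ where
  open Graph G using (_~_)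
  field
    Edge     : Rel (Vertex G) 0ℓ
    Edge-sym : Symmetric Edge
    Edge⊆G   : Edge ⇒ _~_
    -- Every vertex lies on exactly one edge: an edge at u is determined by
    -- its other end.
    matched  : ∀ u → ∃! _≡_ (λ v → Edge u v)

-- The cyclic successor i ↦ i + 1 mod n.
next : ∀ {n} → Fin n → Fin n
next {suc n} i = suc (toℕ i) mod suc n

record Cycle (G : Graph) : Set where
  open Graph G using (_~_)
  field
    len      : ℕ
    3≤len    : 3 ≤ len
    vertex   : Fin len → Vertex G
    distinct : Injective _≡_ _≡_ vertex
    adjacent : ∀ i → vertex i ~ vertex (next i)

  Edge : Rel (Vertex G) 0ℓ
  Edge = SymClosure (λ u v → ∃ λ i → u ≡ vertex i × v ≡ vertex (next i))

record HamiltonianCycle (G : Graph) : Set where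
  field
    cycle : Cycle G
  open Cycle cycle public
  field
    visitsAll : Surjective _≡_ _≡_ vertex

Pairing : Graph → Set₁
Pairing G = PerfectMatching K⟨ G ⟩

-- Only meant for graphs of even order; a graph of odd order has no pairing and
-- satisfies this vacuously.
PHProperty : Graph → Set₁
PHProperty G = (M : Pairing G) →
  Σ[ H ∈ HamiltonianCycle K⟨ G ⟩ ]
    ( PerfectMatching.Edge M ⇒ HamiltonianCycle.Edge H )
  × ( ∀ {u v} → HamiltonianCycle.Edge H u v → ¬ PerfectMatching.Edge M u v → u ~ v )
  where open Graph G using (_~_)

Even Odd : ℕ → Set
Even n = 2 ∣ n
Odd  n = ¬ 2 ∣ n

{-# OPTIONS --safe #-}
-- A Hamiltonian cycle extending the pairing is grown from alternating paths, initially the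
-- edges of the pairing, whose ends are joined inside rows and columns.  Let the rows have even
-- size.  If some path leaves a row, then all ends in that row can be joined within it and the
-- row disappears; so only closed rows remain, each paired within itself.  In a closed row any
-- two cells that are not mates are the ends of an alternating path through the whole row, and
-- any path through the whole row closes up if the row is alone.  With at least four columns,
-- two or three closed rows can be traversed starting and ending in a fixed column, and such
-- pieces are chained along that column.  The 2 × m₂ case with m₂ even is the same argument
-- with the board transposed (2 × 2 apart).
--
-- For 2 × m₂, pair each cell with the other cell of its column.  Every second edge of the
-- cycle then changes the row and the others do not, so going round changes it m₂ times and
-- m₂ is even.
module Submission where

open import Defs
open import Data.Empty using (⊥)
open import Data.Fin.Base using (Fin; zero; suc; toℕ; inject₁; fromℕ; fromℕ<; combine; remQuot; opposite)
import Data.Fin.Properties as Fin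
open import Data.Fin.Relation.Unary.Top using (view; ‵fromℕ; ‵inject₁)
open import Data.List.Base
  using (List; []; _∷_; [_]; _++_; length; map; concatMap; lookup; filter; allFin; cartesianProductWith)
open import Data.List.Membership.Propositional using (_∈_; _∉_)
open import Data.List.Membership.Propositional.Properties
  using (∈-∃++; ∈-lookup; ∈-map⁺; ∈-allFin; ∈-cartesianProductWith⁺; ∈-cartesianProductWith⁻)
import Data.List.Properties as List
open import Data.List.Relation.Binary.Permutation.Propositional
  using (_↭_; refl; prep; swap; ↭-sym; ↭-trans; ↭⇒↭ₛ; module PermutationReasoning)
open import Data.List.Relation.Binary.Permutation.Propositional.Properties
  using ( ++-commutativeMonoid; ++⁺; ++⁺ˡ; ++⁺ʳ; ++-comm; ++-assoc; ++-identityʳ; shift; shifts; drop-∷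
        ; ∈-resp-↭; All-resp-↭; filter-↭; ↭-length; ¬x∷xs↭[])
import Data.List.Relation.Binary.Permutation.Setoid.Properties as Permₛ
open import Data.List.Relation.Unary.All as All using (All; []; _∷_)
import Data.List.Relation.Unary.All.Properties as Allₚ
open import Data.List.Relation.Unary.AllPairs using ([]; _∷_)
open import Data.List.Relation.Unary.Any as Any using (here; there)
open import Data.List.Relation.Unary.Any.Properties using (lookup-index)
open import Data.List.Relation.Unary.Unique.Propositional using (Unique)
import Data.List.Relation.Unary.Unique.Propositional.Properties as Uniqueₚ
open import Data.Nat.Base using (ℕ; zero; suc; _+_; _*_; _%_; _<_; _≤_; z≤n; s≤s)
open import Data.Nat.Divisibility using (_∣_; _∣0; _∣?_; ∣-refl; ∣m∣n⇒∣m+n; ∣m+n∣m⇒∣n)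
import Data.Nat.DivMod as ℕ
open import Data.Nat.GeneralisedArithmetic using (fold)
import Data.Nat.Properties as ℕ
open import Data.Product.Base using (Σ; ∃; ∃₂; _×_; _,_; proj₁; proj₂)
open import Data.Sum.Base as Sum using (_⊎_; inj₁; inj₂)
open import Function.Base using (_∘_)
open import Function.Bundles using (_⇔_; mk⇔)
open import Level using (0ℓ)
open import Relation.Binary.Construct.Closure.Symmetric as Sym using (SymClosure; fwd; bwd)
open import Relation.Binary.Core using (Rel)
open import Relation.Binary.Definitions using (Symmetric)
open import Relation.Binary.PropositionalEquality as ≡
  using (_≡_; _≢_; refl; sym; cong; cong₂; subst)
open import Relation.Nullary using (¬_; Dec; yes; no; contradiction)
open import Relation.Nullary.Decidable using (¬?; decidable-stable; from-no)
open import Relation.Unary using (Pred; Decidable; ∁)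

-- Lists up to permutation

private variable
  A : Set
  P : Pred A 0ℓ
  xs xs′ ys ys′ : List A

Unique-resp-↭ : xs ↭ ys → Unique xs → Unique ys
Unique-resp-↭ ρ = Permₛ.Unique-resp-↭ (≡.setoid _) (↭⇒↭ₛ ρ)

unique-tail : ∀ {x : A} → Unique (x ∷ xs) → Unique xs
unique-tail (_ ∷ xs!) = xs!

head∉tail : ∀ {x : A} → Unique (x ∷ xs) → x ∉ xs
head∉tail (x≢xs ∷ _) = Allₚ.All¬⇒¬Any x≢xs

filter-separates : (P? : Decidable P) → All P xs → All (∁ P) ys → filter P? (xs ++ ys) ≡ xs
filter-separates {xs = xs} {ys = ys} P? pxs ¬pys = ≡.trans (List.filter-++ P? xs ys)
  (≡.trans (cong₂ _++_ (List.filter-all P? pxs) (List.filter-none P? ¬pys)) (List.++-identityʳ xs))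

-- Filtering by `P?` turns each side into its prefix, and `filter` respects permutations.
↭-separateˡ : Decidable P → All P xs → All (∁ P) ys → All P xs′ → All (∁ P) ys′ →
              xs ++ ys ↭ xs′ ++ ys′ → xs ↭ xs′
↭-separateˡ P? pxs ¬pys pxs′ ¬pys′ ρ = begin
  _ ≡⟨ filter-separates P? pxs ¬pys ⟨
  _ ↭⟨ filter-↭ P? ρ ⟩
  _ ≡⟨ filter-separates P? pxs′ ¬pys′ ⟩
  _ ∎
  where open PermutationReasoning

↭-cancelˡ : ∀ (xs : List A) → xs ++ ys ↭ xs ++ ys′ → ys ↭ ys′
↭-cancelˡ []       ρ = ρ
↭-cancelˡ (x ∷ xs) ρ = ↭-cancelˡ xs (drop-∷ ρ)

-- Pigeonhole: if all of `Fin n` lay in `xs`, two different elements would have the same index in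
-- `xs`.
fresh : ∀ {n} (xs : List (Fin n)) → length xs < n → ∃ λ a → a ∉ xs
fresh {n} xs |xs|<n = Fin.¬∀⟶∃¬ n (_∈ xs) (_∈? xs) λ a∈xs →
  let i , j , i<j , eq = Fin.pigeonhole |xs|<n (Any.index ∘ a∈xs)
  in Fin.<⇒≢ i<j (≡.trans (lookup-index (a∈xs i))
       (≡.trans (cong (lookup xs) eq) (sym (lookup-index (a∈xs j)))))
  where open import Data.List.Membership.DecPropositional (Fin._≟_ {n}) using (_∈?_)

-- Alternating paths

module AlternatingPaths
  {V : Set} (partner : V → V) (partner-involutive : ∀ v → partner (partner v) ≡ v)
  (_~_ : Rel V 0ℓ) (~-sym : Symmetric _~_) where

  open import Algebra.Solver.CommutativeMonoid (++-commutativeMonoid {A = V})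
    using (solve; _⊕_; _⊜_)

  -- The list omits the first vertex. Both extreme edges are partner edges, so a link may be added
  -- at either end. Repeated vertices are excluded only later, when the vertices turn out to permute
  -- the list of all cells.
  data Alternating : V → V → List V → Set where
    edge : ∀ {u w} → partner u ≡ w → Alternating u w (w ∷ [])
    step : ∀ {u u′ v w vs} → partner u ≡ u′ → u′ ~ v → Alternating v w vs →
           Alternating u w (u′ ∷ v ∷ vs)

  alternating-++ : ∀ {u v w z vs ws} → Alternating u w vs → w ~ v → Alternating v z ws →
                   Alternating u z (vs ++ v ∷ ws)
  alternating-++ (edge p)     w~v β = step p w~v β
  alternating-++ (step p l α) w~v β = step p l (alternating-++ α w~v β)

  alternating-reverse : ∀ {u w vs} → Alternating u w vs →
                        ∃ λ ws → Alternating w u ws × w ∷ ws ↭ u ∷ vs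
  alternating-reverse (edge refl) = _ , edge (partner-involutive _) , swap _ _ refl
  alternating-reverse (step {u} {_} {v} {w} {vs} refl l α) with alternating-reverse α
  ... | ws , β , ρ = _ , alternating-++ β (~-sym l) (edge (partner-involutive u)) , (begin
    (w ∷ ws) ++ partner u ∷ u ∷ []   ↭⟨ ++-comm (w ∷ ws) _ ⟩
    partner u ∷ u ∷ w ∷ ws           ↭⟨ swap _ _ ρ ⟩
    u ∷ partner u ∷ v ∷ vs           ∎)
    where open PermutationReasoning

  record Path (u w : V) : Set where
    constructor path
    field
      {rest}      : List V
      alternating : Alternating u w rest

  vertices : ∀ {u w} → Path u w → List V
  vertices {u} p = u ∷ Path.rest p

  infixr 5 _▷[_]_
  _▷[_]_ : ∀ {u w v z} → Path u w → w ~ v → Path v z → Path u z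
  path α ▷[ l ] path β = path (alternating-++ α l β)

  flip : ∀ {u w} → Path u w → Path w u
  flip (path α) = path (proj₁ (proj₂ (alternating-reverse α)))

  vertices-flip : ∀ {u w} (p : Path u w) → vertices (flip p) ↭ vertices p
  vertices-flip (path α) = proj₂ (proj₂ (alternating-reverse α))

  Arc : Set
  Arc = ∃₂ Path

  arcEnds arcVertices : Arc → List V
  arcEnds     (u , w , _) = u ∷ w ∷ []
  arcVertices (_ , _ , p) = vertices p

  ends allVertices : List Arc → List V
  ends        = concatMap arcEnds
  allVertices = concatMap arcVertices

  infix 4 _≅_
  -- All that later steps need to know about a family of arcs: neither reversing an arc nor
  -- reordering the family changes it.
  _≅_ : Rel (List Arc) 0ℓ
  as ≅ bs = ends as ↭ ends bs × allVertices as ↭ allVertices bs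

  record Extraction (as : List Arc) (u : V) : Set where
    field
      {other}  : V
      arc      : Path u other
      others   : List Arc
      ≅-whole  : (u , other , arc) ∷ others ≅ as

  -- An arc that finishes at `u` is reversed, so that `u` is a start in either case.
  extract : ∀ as {u} → u ∈ ends as → Extraction as u
  extract ((u , w , p) ∷ as) (here refl) = record { arc = p; others = as; ≅-whole = refl , refl }
  extract ((u , w , p) ∷ as) (there (here refl)) = record
    { arc = flip p; others = as; ≅-whole = swap _ _ refl , ++⁺ʳ _ (vertices-flip p) }
  extract (a ∷ as) (there (there u∈as)) = record
    { arc = arc; others = a ∷ others
    ; ≅-whole = ↭-trans (shifts (_ ∷ _ ∷ []) (arcEnds a)) (++⁺ˡ (arcEnds a) (proj₁ ≅-whole))
              , ↭-trans (shifts (vertices arc) (arcVertices a)) (++⁺ˡ (arcVertices a) (proj₂ ≅-whole)) }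
    where open Extraction (extract as u∈as)

  -- Removes `v` together with its partner; what remains is again closed under `partner`, which is
  -- an involution. The bound `n` drives the recursion, which is not structural in the list.
  matchingArcs : (∀ v → partner v ≢ v) → ∀ n vs → length vs ≤ n → Unique vs →
                 (∀ {v} → v ∈ vs → partner v ∈ vs) →
                 ∃ λ as → ends as ↭ vs × allVertices as ↭ vs
  matchingArcs irr n [] _ _ _ = [] , refl , refl
  matchingArcs irr (suc n) (v ∷ vs) (s≤s |vs|≤n) v∷vs! closed
    with closed (here refl)
  ... | here pv≡v = contradiction pv≡v (irr v)
  ... | there pv∈vs with ∈-∃++ pv∈vs
  ...   | ys , zs , refl =
    let as , ε , ν = matchingArcs irr n (ys ++ zs) (ℕ.<⇒≤ shorter)
                       (unique-tail (unique-tail σ-unique)) closed′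
    in (v , partner v , path (edge refl)) ∷ as , whole ε , whole ν
    where
    σ : v ∷ ys ++ [ partner v ] ++ zs ↭ v ∷ partner v ∷ ys ++ zs
    σ = prep v (shift (partner v) ys zs)
    σ-unique : Unique (v ∷ partner v ∷ ys ++ zs)
    σ-unique = Unique-resp-↭ σ v∷vs!
    shorter : suc (length (ys ++ zs)) ≤ n
    shorter = subst (_≤ n) (↭-length (shift (partner v) ys zs)) |vs|≤n
    closed′ : ∀ {x} → x ∈ ys ++ zs → partner x ∈ ys ++ zs
    closed′ {x} x∈ with ∈-resp-↭ σ (closed (∈-resp-↭ (↭-sym σ) (there (there x∈))))
    ... | here px≡v = contradiction
      (subst (_∈ ys ++ zs) (≡.trans (sym (partner-involutive x)) (cong partner px≡v)) x∈)
      (head∉tail (unique-tail σ-unique))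
    ... | there (here px≡pv) = contradiction
      (there (subst (_∈ ys ++ zs) (≡.trans (sym (partner-involutive x))
        (≡.trans (cong partner px≡pv) (partner-involutive v))) x∈))
      (head∉tail σ-unique)
    ... | there (there px∈) = px∈
    whole : ∀ {ws} → ws ↭ ys ++ zs → v ∷ partner v ∷ ws ↭ v ∷ ys ++ [ partner v ] ++ zs
    whole ρ = ↭-trans (prep v (prep (partner v) ρ)) (↭-sym σ)

  module Clique {S : Pred V 0ℓ} (clique : ∀ {u v} → S u → S v → u ~ v) where

    -- The arcs are appended in the order of the list, each link lying in the clique. Which end
    -- comes last depends on the list, hence the existential `z`.
    joinAll : ∀ {u w} (p : Path u w) → S w → ∀ as → All S (ends as) →
              ∃ λ z → Σ (Path u z) λ q → z ∈ w ∷ ends as × vertices q ↭ vertices p ++ allVertices as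
    joinAll p Sw [] _ = _ , p , here refl , ↭-sym (++-identityʳ _)
    joinAll p Sw ((v , z , q) ∷ as) (Sv ∷ Sz ∷ Sas) =
      let z′ , q′ , z′∈ , ρ = joinAll (p ▷[ clique Sw Sv ] q) Sz as Sas
      in z′ , q′ , there (there z′∈) ,
         ↭-trans ρ (++-assoc (vertices p) (vertices q) (allVertices as))

    module _ as (Sas : All S (ends as)) where

      through : Unique (ends as) → ∀ {u} → u ∈ ends as → ∃ λ w → Σ (Path u w) λ p →
                w ∈ ends as × w ≢ u × vertices p ↭ allVertices as
      through as! {u} u∈as = let w , p , w∈ , ρ = joinAll arc Sother others Sothers in
        w , p , ∈-resp-↭ (proj₁ ≅-whole) (there w∈) ,
        (λ w≡u → head∉tail (Unique-resp-↭ (↭-sym (proj₁ ≅-whole)) as!) (subst (_∈ _) w≡u w∈)) ,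
        ↭-trans ρ (proj₂ ≅-whole)
        where
        open Extraction (extract as u∈as)
        Sends = All-resp-↭ (↭-sym (proj₁ ≅-whole)) Sas
        Sother = All.head (All.tail Sends)
        Sothers = All.tail (All.tail Sends)

      module _ {u} (e : Extraction as u) where
        open Extraction e

        -- The end `w` lies on another arc than `u`. The arc of `u` goes first, that of `w` goes
        -- last and reversed, and all the rest go between.
        joining : ∀ {w} → w ∈ ends as → w ≢ u → w ≢ other → Σ (Path u w) λ p →
                  vertices p ↭ allVertices as
        joining {w} w∈as w≢u w≢other with ∈-resp-↭ (↭-sym (proj₁ ≅-whole)) w∈as
        ... | here w≡u = contradiction w≡u w≢u
        ... | there (here w≡other) = contradiction w≡other w≢other
        ... | there (there w∈) =
          let module F = Extraction (extract others w∈)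
              Sends = All-resp-↭ (↭-sym (proj₁ ≅-whole)) Sas
              Sother = All.head (All.tail Sends)
              Sothers = All-resp-↭ (↭-sym (proj₁ F.≅-whole)) (All.tail (All.tail Sends))
              z , p , z∈ , ρ = joinAll arc Sother F.others (All.tail (All.tail Sothers))
              Sz = All.lookup (Sother ∷ All.tail (All.tail Sothers)) z∈
          in p ▷[ clique Sz (All.head (All.tail Sothers)) ] flip F.arc , (begin
            vertices p ++ vertices (flip F.arc)
              ↭⟨ ++⁺ ρ (vertices-flip F.arc) ⟩
            (vertices arc ++ allVertices F.others) ++ vertices F.arc
              ↭⟨ solve 3 (λ a b c → (a ⊕ b) ⊕ c ⊜ a ⊕ (c ⊕ b)) refl (vertices arc) _ (vertices F.arc) ⟩
            vertices arc ++ vertices F.arc ++ allVertices F.others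
              ↭⟨ ++⁺ˡ (vertices arc) (proj₂ F.≅-whole) ⟩
            vertices arc ++ allVertices others
              ↭⟨ proj₂ ≅-whole ⟩
            allVertices as ∎)
            where open PermutationReasoning

-- Boards of rows and columns

module Grid
  {V : Set} (partner : V → V) (partner-involutive : ∀ v → partner (partner v) ≡ v)
  (partner-≢ : ∀ v → partner v ≢ v)
  {R C : ℕ} (row : V → Fin R) (col : V → Fin C) (cell : Fin R → Fin C → V)
  (row-cell : ∀ r c → row (cell r c) ≡ r) (col-cell : ∀ r c → col (cell r c) ≡ c)
  (cell-η : ∀ v → cell (row v) (col v) ≡ v) where

  open import Algebra.Solver.CommutativeMonoid (++-commutativeMonoid {A = V})
    using (solve; _⊕_; _⊜_)

  -- Equal cells are aligned too; adjacency in the rook graph follows once the cells are known to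
  -- differ.
  Aligned : Rel V 0ℓ
  Aligned u v = row u ≡ row v ⊎ col u ≡ col v

  open AlternatingPaths partner partner-involutive Aligned (Sum.map sym sym) public

  rowCells : Fin R → List V
  rowCells r = map (cell r) (allFin C)

  cells : List (Fin R) → List V
  cells rs = cartesianProductWith cell rs (allFin C)

  InRow : Fin R → Pred V 0ℓ
  InRow r v = row v ≡ r

  inRow? : ∀ r → Decidable (InRow r)
  inRow? r v = row v Fin.≟ r

  cell-injective : ∀ {r r′ c c′} → cell r c ≡ cell r′ c′ → r ≡ r′ × c ≡ c′
  cell-injective {r} {r′} {c} {c′} eq =
    ≡.trans (sym (row-cell r c)) (≡.trans (cong row eq) (row-cell r′ c′)) ,
    ≡.trans (sym (col-cell r c)) (≡.trans (cong col eq) (col-cell r′ c′))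

  cells-unique : ∀ {rs} → Unique rs → Unique (cells rs)
  cells-unique rs! = Uniqueₚ.cartesianProductWith⁺ cell cell-injective rs! (Uniqueₚ.allFin⁺ C)

  rowCells-unique : ∀ r → Unique (rowCells r)
  rowCells-unique r = Uniqueₚ.map⁺ (proj₂ ∘ cell-injective) (Uniqueₚ.allFin⁺ C)

  ∈-rowCells : ∀ r c → cell r c ∈ rowCells r
  ∈-rowCells r c = ∈-map⁺ (cell r) (∈-allFin c)

  rowCells-inRow : ∀ r → All (InRow r) (rowCells r)
  rowCells-inRow r = Allₚ.map⁺ (All.universal (row-cell r) (allFin C))

  inRow-clique : ∀ {r u v} → InRow r u → InRow r v → Aligned u v
  inRow-clique u∈r v∈r = inj₁ (≡.trans u∈r (sym v∈r))

  inRow-cell : ∀ {r v} → InRow r v → ∃ λ c → v ≡ cell r c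
  inRow-cell {v = v} refl = col v , sym (cell-η v)

  same-column : ∀ {r s c} → Aligned (cell r c) (cell s c)
  same-column {r} {s} {c} = inj₂ (≡.trans (col-cell r c) (sym (col-cell s c)))

  -- Only the ends of the arcs fill the row; interior vertices may lie in rows that were eliminated
  -- earlier.
  record ClosedRow : Set where
    field
      index  : Fin R
      arcs   : List Arc
      ends-↭ : ends arcs ↭ rowCells index

    ends-inRow : All (InRow index) (ends arcs)
    ends-inRow = All-resp-↭ (↭-sym ends-↭) (rowCells-inRow index)

    ends-unique : Unique (ends arcs)
    ends-unique = Unique-resp-↭ (↭-sym ends-↭) (rowCells-unique index)

    cell∈ends : ∀ c → cell index c ∈ ends arcs
    cell∈ends c = ∈-resp-↭ (↭-sym ends-↭) (∈-rowCells index c)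

    vertexList : List V
    vertexList = allVertices arcs

  -- Traversing a closed row

  open ClosedRow

  Row⟶ : ClosedRow → Fin C → Fin C → Set
  Row⟶ K b c = Path (cell (index K) b) (cell (index K) c)

  -- What a closed row offers to a path that meets it at column `b`. The field `pathAvoiding` splits
  -- the traversal in two: `mateArc` by itself, and one path through all the other arcs.
  record Port (K : ClosedRow) (b : Fin C) : Set where
    field
      mate         : Fin C
      mateArc      : Row⟶ K b mate
      mate≢        : mate ≢ b
      pathTo       : ∀ c → c ≢ b → c ≢ mate →
                     Σ (Row⟶ K b c) λ p → vertices p ↭ vertexList K
      pathAvoiding : ∀ c → c ≢ b → c ≢ mate → ∃ λ d → d ≢ b × d ≢ mate ×
                     Σ (Row⟶ K c d) λ p → vertices mateArc ++ vertices p ↭ vertexList K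

  port : ∀ K b → Port K b
  port K b with extract (arcs K) (cell∈ends K b)
  ... | record { other = z; arc = α; others = as; ≅-whole = ≅ends , ≅vertices }
      with All-resp-↭ (↭-sym ≅ends) (ends-inRow K)
  ...   | b∈r ∷ z∈r ∷ as∈r with inRow-cell z∈r
  ...     | m , refl = record
    { mate         = m
    ; mateArc      = α
    ; mate≢        = λ m≡b → head∉tail b∷z∷as! (here (cong (cell r) (sym m≡b)))
    ; pathTo       = λ c c≢b c≢m → joining (arcs K) (ends-inRow K) e (cell∈ends K c) (distinct c≢b) (distinct c≢m)
    ; pathAvoiding = avoiding
    }
    where
    r = index K
    open Clique (inRow-clique {r})
    e : Extraction (arcs K) (cell r b)
    e = record { arc = α; others = as; ≅-whole = ≅ends , ≅vertices }
    distinct : ∀ {c d} → c ≢ d → cell r c ≢ cell r d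
    distinct c≢d = c≢d ∘ proj₂ ∘ cell-injective
    b∷z∷as! : Unique (cell r b ∷ cell r m ∷ ends as)
    b∷z∷as! = Unique-resp-↭ (↭-sym ≅ends) (ends-unique K)
    avoiding : ∀ c → c ≢ b → c ≢ m → ∃ λ d → d ≢ b × d ≢ m ×
               Σ (Row⟶ K c d) λ p → vertices α ++ vertices p ↭ vertexList K
    avoiding c c≢b c≢m with ∈-resp-↭ (↭-sym ≅ends) (cell∈ends K c)
    ... | here c≡b = contradiction c≡b (distinct c≢b)
    ... | there (here c≡m) = contradiction c≡m (distinct c≢m)
    -- The arcs other than the one from `b` to `m` also have their ends in the row, and the path
    -- joining them all finishes at one of these ends, hence neither at `b` nor at `m`.
    ... | there (there c∈as) with through as as∈r (unique-tail (unique-tail b∷z∷as!)) c∈as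
    ...   | w , p , w∈as , _ , ρ with inRow-cell (All.lookup as∈r w∈as)
    ...     | d , refl = d ,
      (λ { refl → head∉tail b∷z∷as! (there w∈as) }) ,
      (λ { refl → head∉tail (unique-tail b∷z∷as!) w∈as }) ,
      p , ↭-trans (++⁺ˡ (vertices α) ρ) ≅vertices

  -- Routes that start and end in a fixed column

  module Gadgets (c₀ : Fin C) (4≤C : 4 ≤ C) where

    -- With both ends in column `c₀`, any two routes can be linked and any route closes up.
    Route : List V → Set
    Route vs = ∃₂ λ r s → Σ (Path (cell r c₀) (cell s c₀)) λ p → vertices p ↭ vs

    _then_ : ∀ {vs ws} → Route vs → Route ws → Route (vs ++ ws)
    (_ , _ , p , ρ) then (_ , _ , q , σ) = _ , _ , (p ▷[ same-column ] q) , ++⁺ ρ σ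

    pairRoute : ∀ K L → Route (vertexList K ++ vertexList L)
    pairRoute K L =
      let module A = Port (port K c₀)
          module B = Port (port L c₀)
          -- Four columns leave one that differs from `c₀` and from its mates in both rows; `K` is
          -- crossed from `c₀` to `b`, and `L` from `b` back to `c₀`.
          b , b∉ = fresh (c₀ ∷ A.mate ∷ B.mate ∷ []) 4≤C
          b≢c₀ = b∉ ∘ here
          p , ρ = A.pathTo b b≢c₀ (b∉ ∘ there ∘ here)
          q , σ = B.pathTo b b≢c₀ (b∉ ∘ there ∘ there ∘ here)
      in _ , _ , (p ▷[ same-column ] flip q) , ++⁺ ρ (↭-trans (vertices-flip q) σ)

    -- Generically c₀ → b → a → c₀ through the three rows in turn. This fails for every b only
    -- if C = 4 and the three rows carry the same pairing; then the first row is
    -- entered twice: c₀ → z, z → x (second row), x → y, y → c₀ (third row).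
    tripleRoute : ∀ K L M → Route (vertexList K ++ vertexList L ++ vertexList M)
    tripleRoute K L M with port K c₀ | port M c₀
    ... | A | D = go
      where
      module A = Port A
      module D = Port D
      open import Data.List.Membership.DecPropositional (Fin._≟_ {C}) using (_∈?_)
      z = A.mate
      d = D.mate

      -- Columns at which the second row cannot be left if it is entered at `b`: the first two fail
      -- in `L`, the last two in `M`, which is still to be crossed to `c₀`.
      blocked : ∀ {b} → Port L b → List (Fin C)
      blocked {b} B = b ∷ Port.mate B ∷ c₀ ∷ d ∷ []

      direct : ∀ {b a} (B : Port L b) → b ≢ c₀ → b ≢ z → a ∉ blocked B →
               Route (vertexList K ++ vertexList L ++ vertexList M)
      direct {b} {a} B b≢c₀ b≢z a∉ =
        let p , ρ = A.pathTo b b≢c₀ b≢z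
            q , σ = Port.pathTo B a (a∉ ∘ here) (a∉ ∘ there ∘ here)
            t , τ = D.pathTo a (a∉ ∘ there ∘ there ∘ here) (a∉ ∘ there ∘ there ∘ there ∘ here)
        in _ , _ , (p ▷[ same-column ] q ▷[ same-column ] flip t) ,
           ++⁺ ρ (++⁺ σ (↭-trans (vertices-flip t) τ))

      twice : ∀ {x} (B : Port L x) → x ≢ c₀ → x ≢ z → z ≢ Port.mate B → d ≡ z →
              Route (vertexList K ++ vertexList L ++ vertexList M)
      twice {x} B x≢c₀ x≢z z≢m d≡z =
        let y , y≢c₀ , y≢z , p , ρ = A.pathAvoiding x x≢c₀ x≢z
            q , σ = Port.pathTo B z (x≢z ∘ sym) z≢m
            t , τ = D.pathTo y y≢c₀ (λ y≡d → y≢z (≡.trans y≡d d≡z))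
        in _ , _ , (A.mateArc ▷[ same-column ] flip q ▷[ same-column ] p ▷[ same-column ] flip t) , (begin
          vertices A.mateArc ++ vertices (flip q) ++ vertices p ++ vertices (flip t)
            ↭⟨ solve 4 (λ a b c d → a ⊕ b ⊕ c ⊕ d ⊜ (a ⊕ c) ⊕ b ⊕ d) refl
                 (vertices A.mateArc) (vertices (flip q)) (vertices p) (vertices (flip t)) ⟩
          (vertices A.mateArc ++ vertices p) ++ vertices (flip q) ++ vertices (flip t)
            ↭⟨ ++⁺ ρ (++⁺ (↭-trans (vertices-flip q) σ) (↭-trans (vertices-flip t) τ)) ⟩
          vertexList K ++ vertexList L ++ vertexList M ∎)
        where open PermutationReasoning

      unblockedOrFull : ∀ {b} (B : Port L b) → (∃ λ a → a ∉ blocked B) ⊎ (∀ a → a ∈ blocked B)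
      unblockedOrFull B with Fin.any? (λ a → ¬? (a ∈? blocked B))
      ... | yes a∉ = inj₁ a∉
      ... | no none = inj₂ λ a → decidable-stable (a ∈? blocked B) (λ a∉ → none (a , a∉))

      go : Route (vertexList K ++ vertexList L ++ vertexList M)
      -- `x` and `y` are two candidates for the column in which the first row is left.
      go with fresh (c₀ ∷ z ∷ []) (ℕ.<⇒≤ 4≤C)
      ... | x , x∉ with fresh (c₀ ∷ z ∷ x ∷ []) 4≤C
      ... | y , y∉ with unblockedOrFull (port L x) | unblockedOrFull (port L y)
      ... | inj₁ (_ , a∉) | _ = direct (port L x) (x∉ ∘ here) (x∉ ∘ there ∘ here) a∉
      ... | inj₂ _ | inj₁ (_ , a∉) = direct (port L y) (y∉ ∘ here) (y∉ ∘ there ∘ here) a∉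
      ... | inj₂ fullˣ | inj₂ fullʸ = twice (port L x) x≢c₀ x≢z z≢m d≡z
        where
        x≢c₀ = x∉ ∘ here
        x≢z  = x∉ ∘ there ∘ here
        y≢c₀ = y∉ ∘ here
        y≢z  = y∉ ∘ there ∘ here
        y≢x  = y∉ ∘ there ∘ there ∘ here

        remaining : ∀ {a b m} → a ≢ b → a ≢ c₀ → a ∈ b ∷ m ∷ c₀ ∷ d ∷ [] → a ≡ m ⊎ a ≡ d
        remaining a≢b a≢c₀ (here a≡b)                         = contradiction a≡b a≢b
        remaining a≢b a≢c₀ (there (here a≡m))                 = inj₁ a≡m
        remaining a≢b a≢c₀ (there (there (here a≡c₀)))        = contradiction a≡c₀ a≢c₀
        remaining a≢b a≢c₀ (there (there (there (here a≡d)))) = inj₂ a≡d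

        -- Otherwise `fullʸ` would make both `z` and `x` the mate of `y` in `L`.
        d≢y : d ≢ y
        d≢y refl with remaining (y≢z ∘ sym) A.mate≢ (fullʸ z) | remaining (y≢x ∘ sym) x≢c₀ (fullʸ x)
        ... | inj₁ z≡m | inj₁ x≡m = x≢z (≡.trans x≡m (sym z≡m))
        ... | inj₂ z≡y | _        = y≢z (sym z≡y)
        ... | _        | inj₂ x≡y = y≢x (sym x≡y)

        -- As `d` is not `y`, `fullˣ` leaves for `y` only the mate of `x` in `L`. That mate is then
        -- not `z`, so `fullˣ` forces `z` to be `d`.
        y≡m : y ≡ Port.mate (port L x)
        y≡m with remaining y≢x y≢c₀ (fullˣ y)
        ... | inj₁ y≡m = y≡m
        ... | inj₂ y≡d = contradiction (sym y≡d) d≢y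

        z≢m : z ≢ Port.mate (port L x)
        z≢m z≡m = y≢z (≡.trans y≡m (sym z≡m))

        d≡z : d ≡ z
        d≡z with remaining (x≢z ∘ sym) A.mate≢ (fullˣ z)
        ... | inj₁ z≡m = contradiction z≡m z≢m
        ... | inj₂ z≡d = sym z≡d

    resize : ∀ {vs ws} → vs ↭ ws → Route vs → Route ws
    resize σ (r , s , p , ρ) = r , s , p , ↭-trans ρ σ

    -- Closed rows are consumed two at a time until two or three are left, so that no single row
    -- remains over.
    route : ∀ K L Ms → Route (concatMap vertexList (K ∷ L ∷ Ms))
    route K L [] = resize (++⁺ˡ (vertexList K) (↭-sym (++-identityʳ _))) (pairRoute K L)
    route K L (M ∷ []) =
      resize (++⁺ˡ (vertexList K) (++⁺ˡ (vertexList L) (↭-sym (++-identityʳ _)))) (tripleRoute K L M)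
    route K L (M ∷ N ∷ Ms) = resize (++-assoc (vertexList K) _ _) (pairRoute K L then route M N Ms)

  -- Closing up one or two rows

  ClosedRoute : List V → Set
  ClosedRoute vs = ∃₂ λ u w → Aligned w u × Σ (Path u w) λ p → vertices p ↭ vs

  crossRow : ∀ K c → ∃ λ d → d ≢ c × Σ (Row⟶ K c d) λ p → vertices p ↭ vertexList K
  crossRow K c
    with Clique.through (inRow-clique {index K}) (arcs K) (ends-inRow K) (ends-unique K) (cell∈ends K c)
  ... | w , p , w∈ , w≢ , ρ with inRow-cell (All.lookup (ends-inRow K) w∈)
  ...   | d , refl = d , w≢ ∘ cong (cell (index K)) , p , ρ

  closeRow : Fin C → ∀ K → ClosedRoute (vertexList K)
  closeRow c₀ K =
    let d , _ , p , ρ = crossRow K c₀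
    in _ , _ , inRow-clique (row-cell (index K) d) (row-cell (index K) c₀) , p , ρ

  -- The hypothesis `two` says that there are at most two columns. Each crossing changes the column,
  -- so two crossings return to the first one.
  closeTwoRows : Fin C → (∀ {b c d : Fin C} → c ≢ b → d ≢ c → d ≡ b) →
                 ∀ K L → ClosedRoute (vertexList K ++ vertexList L)
  closeTwoRows c₀ two K L with crossRow K c₀
  ... | c , c≢c₀ , p , ρ with crossRow L c
  ...   | d , d≢c , q , σ with two c≢c₀ d≢c
  ...     | refl = _ , _ , same-column , (p ▷[ same-column ] q) , ++⁺ ρ σ

  -- Elimination of rows

  starts finishes : List Arc → List V
  starts   = map proj₁
  finishes = map (proj₁ ∘ proj₂)

  ends-split : ∀ as → ends as ↭ finishes as ++ starts as
  ends-split [] = refl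
  ends-split ((u , w , p) ∷ as) = begin
    u ∷ w ∷ ends as                  ↭⟨ swap u w (ends-split as) ⟩
    w ∷ u ∷ finishes as ++ starts as ↭⟨ prep w (shift u (finishes as) (starts as)) ⟨
    w ∷ finishes as ++ u ∷ starts as ∎
    where open PermutationReasoning

  record Sorting (r : Fin R) (as : List Arc) : Set where
    field
      inner leaving outer : List Arc
      inner-inRow         : All (InRow r) (ends inner)
      leaving-finish      : All (InRow r) (finishes leaving)
      leaving-start       : All (∁ (InRow r)) (starts leaving)
      outer-notInRow      : All (∁ (InRow r)) (ends outer)
      ends-↭              : ends inner ++ ends leaving ++ ends outer ↭ ends as
      vertices-↭          : allVertices inner ++ allVertices leaving ++ allVertices outer ↭ allVertices as

  sortByRow : ∀ r as → Sorting r as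
  sortByRow r [] = record
    { inner = []; leaving = []; outer = []; inner-inRow = []; leaving-finish = []; leaving-start = []
    ; outer-notInRow = []; ends-↭ = refl; vertices-↭ = refl }
  sortByRow r (a@(u , w , p) ∷ as) with sortByRow r as
  ... | record { inner = is; leaving = ls; outer = os; inner-inRow = is∈; leaving-finish = ls∈
               ; leaving-start = ls∉; outer-notInRow = os∉; ends-↭ = ε; vertices-↭ = ν } =
    place (inRow? r u) (inRow? r w)
    where
    second : ∀ (xs ys zs ws vs : List V) → ys ++ zs ++ ws ↭ vs → ys ++ (xs ++ zs) ++ ws ↭ xs ++ vs
    second xs ys zs ws vs ρ = ↭-trans
      (solve 4 (λ x y z w → y ⊕ (x ⊕ z) ⊕ w ⊜ x ⊕ (y ⊕ z ⊕ w)) refl xs ys zs ws) (++⁺ˡ xs ρ)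
    third : ∀ (xs ys zs ws vs : List V) → ys ++ zs ++ ws ↭ vs → ys ++ zs ++ xs ++ ws ↭ xs ++ vs
    third xs ys zs ws vs ρ = ↭-trans
      (solve 4 (λ x y z w → y ⊕ z ⊕ x ⊕ w ⊜ x ⊕ (y ⊕ z ⊕ w)) refl xs ys zs ws) (++⁺ˡ xs ρ)
    place : Dec (InRow r u) → Dec (InRow r w) → Sorting r (a ∷ as)
    place (yes u∈r) (yes w∈r) = record
      { inner = a ∷ is; leaving = ls; outer = os; inner-inRow = u∈r ∷ w∈r ∷ is∈; leaving-finish = ls∈
      ; leaving-start = ls∉; outer-notInRow = os∉
      ; ends-↭ = prep u (prep w ε)
      ; vertices-↭ = ↭-trans (++-assoc (vertices p) _ _) (++⁺ˡ (vertices p) ν) }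
    place (no u∉r) (yes w∈r) = record
      { inner = is; leaving = a ∷ ls; outer = os; inner-inRow = is∈; leaving-finish = w∈r ∷ ls∈
      ; leaving-start = u∉r ∷ ls∉; outer-notInRow = os∉
      ; ends-↭ = second (u ∷ w ∷ []) (ends is) (ends ls) (ends os) (ends as) ε
      ; vertices-↭ = second (vertices p) (allVertices is) (allVertices ls) (allVertices os) (allVertices as) ν }
    -- Leaving arcs must finish in the row, so this one is reversed.
    place (yes u∈r) (no w∉r) = record
      { inner = is; leaving = (w , u , flip p) ∷ ls; outer = os; inner-inRow = is∈; leaving-finish = u∈r ∷ ls∈
      ; leaving-start = w∉r ∷ ls∉; outer-notInRow = os∉
      ; ends-↭ = ↭-trans (second (w ∷ u ∷ []) (ends is) (ends ls) (ends os) (ends as) ε) (swap w u refl)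
      ; vertices-↭ = ↭-trans
          (second (vertices (flip p)) (allVertices is) (allVertices ls) (allVertices os) (allVertices as) ν)
          (++⁺ʳ _ (vertices-flip p)) }
    place (no u∉r) (no w∉r) = record
      { inner = is; leaving = ls; outer = a ∷ os; inner-inRow = is∈; leaving-finish = ls∈
      ; leaving-start = ls∉; outer-notInRow = u∉r ∷ w∉r ∷ os∉
      ; ends-↭ = third (u ∷ w ∷ []) (ends is) (ends ls) (ends os) (ends as) ε
      ; vertices-↭ = third (vertices p) (allVertices is) (allVertices ls) (allVertices os) (allVertices as) ν }

  ends-length-even : ∀ as → 2 ∣ length (ends as)
  ends-length-even []       = (2 ∣0)
  ends-length-even (_ ∷ as) = ∣m∣n⇒∣m+n ∣-refl (ends-length-even as)

  -- Two arcs finishing in the same row are linked there, the second one reversed. Their finishes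
  -- become interior and their starts are the ends of the new arc.
  joinInPairs : ∀ {r} as → 2 ∣ length as → All (InRow r) (finishes as) →
                ∃ λ bs → ends bs ↭ starts as × allVertices bs ↭ allVertices as
  joinInPairs [] _ _ = [] , refl , refl
  joinInPairs (_ ∷ []) 2∣1 _ = contradiction 2∣1 (from-no (2 ∣? 1))
  joinInPairs ((u , w , p) ∷ (v , z , q) ∷ as) 2∣2+n (w∈r ∷ z∈r ∷ as∈r) =
    let bs , ε , ν = joinInPairs as (∣m+n∣m⇒∣n 2∣2+n ∣-refl) as∈r
    in (u , v , p ▷[ inRow-clique w∈r z∈r ] flip q) ∷ bs , prep u (prep v ε) , (begin
      (vertices p ++ vertices (flip q)) ++ allVertices bs
        ↭⟨ ++⁺ (++⁺ˡ (vertices p) (vertices-flip q)) ν ⟩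
      (vertices p ++ vertices q) ++ allVertices as
        ↭⟨ ++-assoc (vertices p) _ _ ⟩
      vertices p ++ vertices q ++ allVertices as ∎)
    where open PermutationReasoning

  -- A row that some arc leaves is eliminated: the arcs inside it are appended to a leaving
  -- arc, and then the leaving arcs, even in number, are joined in pairs.
  reduce : 2 ∣ C → ∀ {rs} → Unique rs → ∀ as → ends as ↭ cells rs →
           ∃ λ Ks → concatMap vertexList Ks ↭ allVertices as × length Ks ≤ length rs
  reduce 2∣C {[]} _ [] _ = [] , refl , z≤n
  reduce 2∣C {[]} _ (_ ∷ _) ε = contradiction ε ¬x∷xs↭[]
  reduce 2∣C {r ∷ rs} r∷rs! as ε with sortByRow r as
  ... | record { inner = is; leaving = ls; outer = os; inner-inRow = is∈; leaving-finish = ls∈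
               ; leaving-start = ls∉; outer-notInRow = os∉; ends-↭ = ε′; vertices-↭ = ν′ } =
    eliminate ls ls∈ ls∉ here-row other-rows ν′
    where
    rest∉ : All (∁ (InRow r)) (cells rs)
    rest∉ = All.tabulate λ v∈ → λ v∈r →
      let r′ , c , r′∈rs , _ , v≡ = ∈-cartesianProductWith⁻ cell rs (allFin C) v∈
      in head∉tail r∷rs! (subst (_∈ rs)
           (≡.trans (sym (row-cell r′ c)) (≡.trans (cong row (sym v≡)) v∈r)) r′∈rs)
    rearranged : (ends is ++ finishes ls) ++ (starts ls ++ ends os) ↭ rowCells r ++ cells rs
    rearranged = begin
      (ends is ++ finishes ls) ++ (starts ls ++ ends os)
        ↭⟨ solve 4 (λ i f s o → (i ⊕ f) ⊕ (s ⊕ o) ⊜ i ⊕ (f ⊕ s) ⊕ o) refl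
             (ends is) (finishes ls) (starts ls) (ends os) ⟩
      ends is ++ (finishes ls ++ starts ls) ++ ends os
        ↭⟨ ++⁺ˡ (ends is) (++⁺ʳ (ends os) (ends-split ls)) ⟨
      ends is ++ ends ls ++ ends os
        ↭⟨ ε′ ⟩
      ends as
        ↭⟨ ε ⟩
      rowCells r ++ cells rs ∎
      where open PermutationReasoning
    -- Ends in row `r` belong to inner arcs or are finishes of leaving ones; all other ends lie
    -- elsewhere, so separating by row applies.
    here-row : ends is ++ finishes ls ↭ rowCells r
    here-row = ↭-separateˡ (inRow? r) (Allₚ.++⁺ is∈ ls∈) (Allₚ.++⁺ ls∉ os∉) (rowCells-inRow r) rest∉ rearranged
    other-rows : starts ls ++ ends os ↭ cells rs
    other-rows = ↭-cancelˡ (rowCells r) (↭-trans (++⁺ʳ _ (↭-sym here-row)) rearranged)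
    eliminate : ∀ ls → All (InRow r) (finishes ls) → All (∁ (InRow r)) (starts ls) →
                ends is ++ finishes ls ↭ rowCells r → starts ls ++ ends os ↭ cells rs →
                allVertices is ++ allVertices ls ++ allVertices os ↭ allVertices as →
                ∃ λ Ks → concatMap vertexList Ks ↭ allVertices as × length Ks ≤ suc (length rs)
    -- No arc leaves the row, so its inner arcs form a closed row.
    eliminate [] _ _ full others ν =
      let Ks , κ , |Ks|≤ = reduce 2∣C (unique-tail r∷rs!) os others
      in record { index = r; arcs = is; ends-↭ = ↭-trans (↭-sym (++-identityʳ _)) full } ∷ Ks ,
         ↭-trans (++⁺ˡ (allVertices is) κ) ν , s≤s |Ks|≤
    eliminate ((u , w , p) ∷ ls) (w∈r ∷ ls∈r) _ full others ν =
      -- Having absorbed the inner arcs, the first leaving arc still starts at `u` and still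
      -- finishes in the row, now at `z`.
      let z , q , z∈ , ρ = Clique.joinAll (inRow-clique {r}) p w∈r is is∈
          bs , β , νᵇ = joinInPairs ((u , z , q) ∷ ls) even (All.lookup (w∈r ∷ is∈) z∈ ∷ ls∈r)
          Ks , κ , |Ks|≤ = reduce 2∣C (unique-tail r∷rs!) (bs ++ os) (begin
            ends (bs ++ os)     ≡⟨ List.concatMap-++ arcEnds bs os ⟩
            ends bs ++ ends os  ↭⟨ ++⁺ʳ (ends os) β ⟩
            _                   ↭⟨ others ⟩
            cells rs            ∎)
      in Ks , (begin
           concatMap vertexList Ks
             ↭⟨ κ ⟩
           allVertices (bs ++ os)
             ≡⟨ List.concatMap-++ arcVertices bs os ⟩
           allVertices bs ++ allVertices os
             ↭⟨ ++⁺ʳ (allVertices os) (↭-trans νᵇ (++⁺ʳ (allVertices ls) ρ)) ⟩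
           ((vertices p ++ allVertices is) ++ allVertices ls) ++ allVertices os
             ↭⟨ solve 4 (λ p i l o → ((p ⊕ i) ⊕ l) ⊕ o ⊜ i ⊕ (p ⊕ l) ⊕ o) refl
                  (vertices p) (allVertices is) (allVertices ls) (allVertices os) ⟩
           allVertices is ++ (vertices p ++ allVertices ls) ++ allVertices os
             ↭⟨ ν ⟩
           allVertices as ∎) , ℕ.m≤n⇒m≤1+n |Ks|≤
      where
      open PermutationReasoning
      row-length : length (ends is) + suc (length ls) ≡ C
      row-length = ≡.trans (cong (length (ends is) +_) (cong suc (sym (List.length-map _ ls))))
        (≡.trans (sym (List.length-++ (ends is))) (≡.trans (↭-length full)
          (≡.trans (List.length-map _ (allFin C)) (List.length-tabulate {n = C} _))))
      -- Of the `C` cells of the row, an even number, the inner arcs account for an even number and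
      -- each leaving arc for one.
      even : 2 ∣ suc (length ls)
      even = ∣m+n∣m⇒∣n (subst (2 ∣_) (sym row-length) 2∣C) (ends-length-even is)

  -- Closed routes through all cells

  allCells : List V
  allCells = cells (allFin R)

  allCells-unique : Unique allCells
  allCells-unique = cells-unique (Uniqueₚ.allFin⁺ R)

  ∈-allCells : ∀ v → v ∈ allCells
  ∈-allCells v = subst (_∈ allCells) (cell-η v)
    (∈-cartesianProductWith⁺ cell (∈-allFin (row v)) (∈-allFin (col v)))

  length-cells : ∀ rs → length (cells rs) ≡ length rs * C
  length-cells []       = refl
  length-cells (r ∷ rs) = ≡.trans (List.length-++ (rowCells r)) (cong₂ _+_
    (≡.trans (List.length-map _ (allFin C)) (List.length-tabulate {n = C} _)) (length-cells rs))

  length-allCells : length allCells ≡ R * C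
  length-allCells = ≡.trans (length-cells (allFin R)) (cong (_* C) (List.length-tabulate {n = R} _))

  -- The bound on the number of closed rows serves the 2 × 2 board, where at most two can remain.
  reducedRows : 2 ∣ C → ∃ λ Ks → concatMap vertexList Ks ↭ allCells × length Ks ≤ R
  reducedRows 2∣C =
    let as , ε , ν =
          matchingArcs partner-≢ (length allCells) allCells ℕ.≤-refl allCells-unique (λ _ → ∈-allCells _)
        Ks , κ , |Ks|≤ = reduce 2∣C (Uniqueₚ.allFin⁺ R) as ε
    in Ks , ↭-trans κ ν , subst (length Ks ≤_) (List.length-tabulate {n = R} _) |Ks|≤

  resizeClosed : ∀ {vs ws} → vs ↭ ws → ClosedRoute vs → ClosedRoute ws
  resizeClosed σ (u , w , l , p , ρ) = u , w , l , p , ↭-trans ρ σ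

  hamiltonian : 2 ∣ C → 4 ≤ C → Fin R → ClosedRoute allCells
  hamiltonian 2∣C 4≤C r₀ with reducedRows 2∣C
  -- Without closed rows there would be no cells. Any column would do here and below; `4≤C`, read as
  -- `3 < C`, supplies one.
  ... | [] , ρ , _ = contradiction (∈-resp-↭ (↭-sym ρ) (∈-allCells (cell r₀ (fromℕ< 4≤C)))) λ ()
  ... | K ∷ [] , ρ , _ = resizeClosed (↭-trans (↭-sym (++-identityʳ _)) ρ) (closeRow (fromℕ< 4≤C) K)
  ... | K ∷ L ∷ Ks , ρ , _ =
    let _ , _ , p , σ = Gadgets.route (fromℕ< 4≤C) 4≤C K L Ks
    in _ , _ , same-column , p , ↭-trans σ ρ

  hamiltonian₂ : 2 ∣ C → R ≤ 2 → Fin R → Fin C → (∀ {b c d : Fin C} → c ≢ b → d ≢ c → d ≡ b) →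
                 ClosedRoute allCells
  hamiltonian₂ 2∣C R≤2 r₀ c₀ two with reducedRows 2∣C
  ... | [] , ρ , _ = contradiction (∈-resp-↭ (↭-sym ρ) (∈-allCells (cell r₀ c₀))) λ ()
  ... | K ∷ [] , ρ , _ = resizeClosed (↭-trans (↭-sym (++-identityʳ _)) ρ) (closeRow c₀ K)
  ... | K ∷ L ∷ [] , ρ , _ =
    resizeClosed (↭-trans (++⁺ˡ (vertexList K) (↭-sym (++-identityʳ _))) ρ) (closeTwoRows c₀ two K L)
  ... | _ ∷ _ ∷ _ ∷ _ , _ , 3≤R = contradiction (ℕ.≤-trans 3≤R R≤2) λ { (s≤s (s≤s ())) }

-- The cyclic successor

toℕ-next : ∀ {n} (i : Fin (suc n)) → toℕ (next i) ≡ suc (toℕ i) % suc n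
toℕ-next i = Fin.toℕ-fromℕ< _

next-inject₁ : ∀ {n} (i : Fin n) → next (inject₁ i) ≡ suc i
next-inject₁ {n} i = Fin.toℕ-injective (≡.trans (toℕ-next (inject₁ i))
  (≡.trans (cong (λ k → suc k % suc n) (Fin.toℕ-inject₁ i)) (ℕ.m<n⇒m%n≡m (s≤s (Fin.toℕ<n i)))))

next-fromℕ : ∀ n → next (fromℕ n) ≡ zero
next-fromℕ n = Fin.toℕ-injective (≡.trans (toℕ-next (fromℕ n))
  (≡.trans (cong (λ k → suc k % suc n) (Fin.toℕ-fromℕ n)) (ℕ.n%n≡0 (suc n))))

next-injective : ∀ {n} {i j : Fin n} → next i ≡ next j → i ≡ j
next-injective {suc n} {i} {j} eq with view i | view j
... | ‵fromℕ     | ‵fromℕ     = refl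
... | ‵fromℕ     | ‵inject₁ j = contradiction
  (≡.trans (sym (next-fromℕ n)) (≡.trans eq (next-inject₁ j))) λ ()
... | ‵inject₁ i | ‵fromℕ     = contradiction
  (≡.trans (sym (next-inject₁ i)) (≡.trans eq (next-fromℕ n))) λ ()
... | ‵inject₁ i | ‵inject₁ j = cong inject₁ (Fin.suc-injective
  (≡.trans (sym (next-inject₁ i)) (≡.trans eq (next-inject₁ j))))

-- With at most two positions, two steps would lead back. This keeps apart consecutive vertices of a
-- cycle, and also the two cycle edges at a vertex.
next-next-≢ : ∀ {n} → 3 ≤ n → (i : Fin n) → next (next i) ≢ i
next-next-≢ {suc zero} (s≤s ())
next-next-≢ {suc (suc zero)} (s≤s (s≤s ()))
next-next-≢ {suc (suc (suc n))} _ i eq with view i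
... | ‵fromℕ = contradiction
  (≡.trans (sym (≡.trans (cong next (next-fromℕ (suc (suc n)))) (next-inject₁ zero))) eq) λ ()
... | ‵inject₁ j with view j
...   | ‵inject₁ k = ℕ.m≢1+n+m (toℕ k) {1} (sym (≡.trans (cong toℕ
        (≡.trans (sym (≡.trans (cong next (next-inject₁ (inject₁ k))) (next-inject₁ (suc k)))) eq))
        (≡.trans (Fin.toℕ-inject₁ (inject₁ k)) (Fin.toℕ-inject₁ k))))
...   | ‵fromℕ = contradiction
        (≡.trans (sym (≡.trans (cong next (next-inject₁ (fromℕ (suc n)))) (next-fromℕ (suc (suc n))))) eq) λ ()

lookup-injective : ∀ {A : Set} {xs : List A} → Unique xs → ∀ i j → lookup xs i ≡ lookup xs j → i ≡ j
lookup-injective (_ ∷ _)    zero    zero    _  = refl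
lookup-injective (x∉ ∷ _)   zero    (suc j) eq = contradiction eq (All.lookup x∉ (∈-lookup j))
lookup-injective (x∉ ∷ _)   (suc i) zero    eq = contradiction (sym eq) (All.lookup x∉ (∈-lookup i))
lookup-injective (_ ∷ xs!)  (suc i) (suc j) eq = cong suc (lookup-injective xs! i j eq)

-- The involution given by a pairing

module PairingPartner (G : Graph) (M : Pairing G) where
  open Graph G using (Vertex)
  open PerfectMatching M

  partner : Vertex → Vertex
  partner v = proj₁ (matched v)

  edge-partner : ∀ v → Edge v (partner v)
  edge-partner v = proj₁ (proj₂ (matched v))

  partner-unique : ∀ {u v} → Edge u v → partner u ≡ v
  partner-unique e = proj₂ (proj₂ (matched _)) e

  partner-involutive : ∀ v → partner (partner v) ≡ v
  partner-involutive v = partner-unique (Edge-sym (edge-partner v))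

  partner-≢ : ∀ v → partner v ≢ v
  partner-≢ v = Edge⊆G (edge-partner v) ∘ sym

-- From closed alternating paths to Hamiltonian cycles

module Closing
  {V : Set} (partner : V → V) (partner-involutive : ∀ v → partner (partner v) ≡ v)
  (_~_ : V → V → Set) (~-sym : ∀ {u v} → u ~ v → v ~ u) where
  open AlternatingPaths partner partner-involutive _~_ ~-sym

  -- An index `i` into `xs` stands for the positions `i` and `i + 1` of the whole list; the pair
  -- that wraps around is left out.
  Successive : List V → V → V → Set
  Successive []       u v = ⊥
  Successive (x ∷ xs) u v = ∃ λ i → u ≡ lookup (x ∷ xs) (inject₁ i) × v ≡ lookup xs i

  successive-there : ∀ {x xs u v} → Successive xs u v → Successive (x ∷ xs) u v
  successive-there {xs = _ ∷ _} (i , p , q) = suc i , p , q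

  alternating-step : ∀ {u w vs} → Alternating u w vs → ∀ i →
                     let a = lookup (u ∷ vs) (inject₁ i); b = lookup vs i in b ≡ partner a ⊎ a ~ b
  alternating-step (edge refl)     zero          = inj₁ refl
  alternating-step (step refl _ _) zero          = inj₁ refl
  alternating-step (step refl l _) (suc zero)    = inj₂ l
  alternating-step (step refl _ α) (suc (suc i)) = alternating-step α i

  -- The first, third, fifth and so on up to the last edge of the path are partner edges and cover
  -- all its vertices, so the closing link is not involved.
  alternating-partner : ∀ {u w vs} → Alternating u w vs → ∀ {v} → v ∈ u ∷ vs →
                        SymClosure (Successive (u ∷ vs)) v (partner v)
  alternating-partner (edge refl) (here refl) = fwd (zero , refl , refl)
  alternating-partner (edge refl) (there (here refl)) = bwd (zero , partner-involutive _ , refl)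
  alternating-partner (step refl _ _) (here refl) = fwd (zero , refl , refl)
  alternating-partner (step refl _ _) (there (here refl)) = bwd (zero , partner-involutive _ , refl)
  alternating-partner (step refl _ α) (there (there v∈)) =
    Sym.map (successive-there ∘ successive-there) (alternating-partner α v∈)

  alternating-last : ∀ {u w vs} → Alternating u w vs → lookup (u ∷ vs) (fromℕ (length vs)) ≡ w
  alternating-last (edge _)     = refl
  alternating-last (step _ _ α) = alternating-last α

module HamiltonianClosing
  (G : Graph) (M : Pairing G) (_≈_ : Graph.Vertex G → Graph.Vertex G → Set)
  (≈-sym : ∀ {u v} → u ≈ v → v ≈ u)
  (≈⇒~ : ∀ {u v} → u ≈ v → u ≢ v → Graph._~_ G u v) where

  open PairingPartner G M
  open AlternatingPaths partner partner-involutive _≈_ ≈-sym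
  open Closing partner partner-involutive _≈_ ≈-sym

  hamiltonianCycle :
    ∀ {u w vs} → Alternating u w vs → w ≈ u → 3 ≤ length (u ∷ vs) →
    Unique (u ∷ vs) → (∀ v → v ∈ u ∷ vs) →
    Σ (HamiltonianCycle K⟨ G ⟩) λ H →
      (∀ {a b} → PerfectMatching.Edge M a b → HamiltonianCycle.Edge H a b) ×
      (∀ {a b} → HamiltonianCycle.Edge H a b → ¬ PerfectMatching.Edge M a b → Graph._~_ G a b)
  hamiltonianCycle {u} {w} {vs} α w≈u 3≤n vs! all = H , M⊆H , H∖M⊆G
    where
    vertex : Fin (length (u ∷ vs)) → Graph.Vertex G
    vertex = lookup (u ∷ vs)

    distinct : ∀ {i j} → vertex i ≡ vertex j → i ≡ j
    distinct = lookup-injective vs! _ _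

    adjacent : ∀ i → vertex i ≢ vertex (next i)
    -- A fixed point of `next` would also be fixed by two steps.
    adjacent i eq = next-next-≢ 3≤n i (≡.trans (cong next (sym (distinct eq))) (sym (distinct eq)))

    H : HamiltonianCycle K⟨ G ⟩
    H = record
      { cycle = record
          { len = length (u ∷ vs); 3≤len = 3≤n; vertex = vertex; distinct = distinct; adjacent = adjacent }
      ; visitsAll = λ v → Any.index (all v) , λ { refl → sym (lookup-index (all v)) }
      }

    successive⇒edge : ∀ {a b} → Successive (u ∷ vs) a b → ∃ λ i → a ≡ vertex i × b ≡ vertex (next i)
    successive⇒edge (i , p , q) = inject₁ i , p , ≡.trans q (cong vertex (sym (next-inject₁ i)))

    M⊆H : ∀ {a b} → PerfectMatching.Edge M a b → HamiltonianCycle.Edge H a b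
    M⊆H {a} e = subst (HamiltonianCycle.Edge H a) (partner-unique e)
      (Sym.map successive⇒edge (alternating-partner α (all a)))

    -- Only at the top index does the cycle use the closing link from `w` to `u`; below it, its
    -- edges are those of the path.
    link : ∀ i → vertex (next i) ≡ partner (vertex i) ⊎ vertex i ≈ vertex (next i)
    link i with view i
    ... | ‵fromℕ rewrite next-fromℕ (length vs) | alternating-last α = inj₂ w≈u
    ... | ‵inject₁ j rewrite next-inject₁ j = alternating-step α j

    unmatched : ∀ i → ¬ PerfectMatching.Edge M (vertex i) (vertex (next i)) →
                Graph._~_ G (vertex i) (vertex (next i))
    unmatched i ¬e with link i
    ... | inj₁ eq = contradiction
      (subst (PerfectMatching.Edge M (vertex i)) (sym eq) (edge-partner (vertex i))) ¬e
    ... | inj₂ l = ≈⇒~ l (adjacent i)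

    H∖M⊆G : ∀ {a b} → HamiltonianCycle.Edge H a b → ¬ PerfectMatching.Edge M a b → Graph._~_ G a b
    H∖M⊆G (fwd (i , refl , refl)) ¬e = unmatched i ¬e
    H∖M⊆G (bwd (i , refl , refl)) ¬e = Graph.~-sym G (unmatched i (¬e ∘ PerfectMatching.Edge-sym M))

-- Parity of going once round a cycle

toℕ-fold-next : ∀ n k → toℕ (fold (zero {n}) next k) ≡ k % suc n
toℕ-fold-next n zero    = refl
toℕ-fold-next n (suc k) = begin
  toℕ (next (fold zero next k))               ≡⟨ toℕ-next (fold zero next k) ⟩
  suc (toℕ (fold (zero {n}) next k)) % suc n  ≡⟨ cong (λ l → suc l % suc n) (toℕ-fold-next n k) ⟩
  suc (k % suc n) % suc n                     ≡⟨ ℕ.%-distribˡ-+ 1 (k % suc n) (suc n) ⟩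
  (1 % suc n + k % suc n % suc n) % suc n  ≡⟨ cong (λ l → (1 % suc n + l) % suc n) (ℕ.m%n%n≡m%n k (suc n)) ⟩
  (1 % suc n + k % suc n) % suc n          ≡⟨ ℕ.%-distribˡ-+ 1 k (suc n) ⟨
  suc k % suc n ∎
  where
  open ≡.≡-Reasoning

fold-next-length : ∀ n → fold (zero {n}) next (suc n) ≡ zero
fold-next-length n = Fin.toℕ-injective (≡.trans (toℕ-fold-next n (suc n)) (ℕ.n%n≡0 (suc n)))

opposite-≢ : ∀ (a : Fin 2) → opposite a ≢ a
opposite-≢ zero ()
opposite-≢ (suc zero) ()

opposite-flips : ∀ {a b : Fin 2} → a ≢ b → b ≡ opposite a
opposite-flips {zero}     {zero}     a≢b = contradiction refl a≢b
opposite-flips {zero}     {suc zero} a≢b = refl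
opposite-flips {suc zero} {zero}     a≢b = refl
opposite-flips {suc zero} {suc zero} a≢b = contradiction refl a≢b

fold-opposite-even : ∀ (a : Fin 2) k → fold a opposite k ≡ a → 2 ∣ k
fold-opposite-even a zero          _  = 2 ∣0
fold-opposite-even a (suc zero)    eq = contradiction eq (opposite-≢ a)
fold-opposite-even a (suc (suc k)) eq = ∣m∣n⇒∣m+n ∣-refl
  (fold-opposite-even a k (≡.trans (sym (Fin.opposite-involutive (fold a opposite k))) eq))

-- Two steps flip the side and `n` double steps go round once, so `n` flips restore the side of
-- position `zero`.
side-parity : ∀ {N n} (side : Fin N → Fin 2) →
              (∀ i → side (next (next i)) ≡ opposite (side i)) → N ≡ n * 2 → 2 ∣ n
side-parity {zero}  {zero} _ _ _ = 2 ∣0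
side-parity {suc N} {n} side turn N≡2n = fold-opposite-even (side zero) n (begin
  fold (side zero) opposite n ≡⟨ turns n ⟨
  side (fold zero next (n * 2)) ≡⟨ cong (side ∘ fold zero next) N≡2n ⟨
  side (fold zero next (suc N)) ≡⟨ cong side (fold-next-length N) ⟩
  side zero ∎)
  where
  open ≡.≡-Reasoning
  turns : ∀ k → side (fold zero next (k * 2)) ≡ fold (side zero) opposite k
  turns zero    = refl
  turns (suc k) = ≡.trans (turn (fold zero next (k * 2))) (cong opposite (turns k))

-- The 2 × n board with n odd

rung : ∀ {n} → Fin 2 × Fin n → Fin 2 × Fin n
rung (a , b) = opposite a , b

rung-involutive : ∀ {n} (v : Fin 2 × Fin n) → rung (rung v) ≡ v
rung-involutive (a , b) = cong (_, b) (Fin.opposite-involutive a)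

rungs : ∀ n → Pairing (K 2 □ K n)
rungs n = record
  { Edge     = λ u v → v ≡ rung u
  ; Edge-sym = λ { {u} refl → sym (rung-involutive u) }
  ; Edge⊆G   = λ { {u} v≡ u≡v → opposite-≢ (proj₁ u) (cong proj₁ (sym (≡.trans u≡v v≡))) }
  ; matched  = λ u → rung u , refl , sym
  }

-- Numbering the cells injects the positions on the cycle into `Fin (m * n)`, and choosing preimages
-- under the surjection `vertex` gives an injection back.
hamiltonian-len : ∀ {m n} (H : HamiltonianCycle K⟨ K m □ K n ⟩) → HamiltonianCycle.len H ≡ m * n
hamiltonian-len {m} {n} H = Fin.cantor-schröder-bernstein {f = number} {g = position}
  (λ {i} {j} eq → distinct (let p , q = Fin.combine-injective _ _ _ _ eq in cong₂ _,_ p q))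
  (λ {x} {y} eq → begin
    x                             ≡⟨ numbered x ⟨
    number (position x)           ≡⟨ cong number eq ⟩
    number (position y)           ≡⟨ numbered y ⟩
    y                             ∎)
  where
  open HamiltonianCycle H
  open ≡.≡-Reasoning
  number : Fin len → Fin (m * n)
  number i = combine (proj₁ (vertex i)) (proj₂ (vertex i))
  position : Fin (m * n) → Fin len
  position x = proj₁ (visitsAll (remQuot n x))
  numbered : ∀ x → number (position x) ≡ x
  numbered x = ≡.trans (cong (λ v → combine (proj₁ v) (proj₂ v)) (proj₂ (visitsAll (remQuot n x)) refl))
                       (Fin.combine-remQuot {m} n x)

prism-¬PH : ∀ n → Odd n → ¬ PHProperty (K 2 □ K n)
prism-¬PH n n-odd ph with ph (rungs n)
... | H , M⊆H , H∖M⊆G =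
  n-odd (side-parity side side-next-next (≡.trans (hamiltonian-len H) (ℕ.*-comm 2 n)))
  where
  open HamiltonianCycle H

  side : Fin len → Fin 2
  side = proj₁ ∘ vertex

  -- A cycle edge outside the pairing is a rook move; if it changed the side, it would keep the
  -- column and thus be a rung.
  side-constant : ∀ i → vertex (next i) ≢ rung (vertex i) → side (next i) ≡ side i
  side-constant i ¬rung with H∖M⊆G (fwd (i , refl , refl)) ¬rung
  ... | inj₁ (same , _)    = sym same
  ... | inj₂ (flips , col) = contradiction (cong₂ _,_ (opposite-flips flips) (sym col)) ¬rung

  -- Two rungs in succession would lead back to the same vertex.
  not-both : ∀ i → vertex (next (next i)) ≡ rung (vertex (next i)) → vertex (next i) ≢ rung (vertex i)
  not-both i after before = next-next-≢ 3≤len i (distinct (begin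
    vertex (next (next i))      ≡⟨ after ⟩
    rung (vertex (next i))      ≡⟨ cong rung before ⟩
    rung (rung (vertex i))      ≡⟨ rung-involutive (vertex i) ⟩
    vertex i                    ∎))
    where open ≡.≡-Reasoning

  -- Exactly one of the two cycle edges at a vertex is a rung, and the other one stays on its side.
  side-next-next : ∀ i → side (next (next i)) ≡ opposite (side i)
  side-next-next i with M⊆H {vertex (next i)} refl
  ... | fwd (j , p , q) with distinct p
  ...   | refl = ≡.trans (cong proj₁ (sym q)) (cong opposite (side-constant i (not-both i (sym q))))
  side-next-next i | bwd (j , p , q) with next-injective (distinct q)
  ...   | refl = ≡.trans (side-constant (next i) (λ after → not-both i after before)) (cong proj₁ before)
    where
    before : vertex (next i) ≡ rung (vertex i)
    before = ≡.trans (sym (rung-involutive (vertex (next i)))) (cong rung p)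

-- Rook graphs that have the PH-property

module OrientedRook
  (m n : ℕ) {R C : ℕ}
  (row : Fin m × Fin n → Fin R) (col : Fin m × Fin n → Fin C) (cell : Fin R → Fin C → Fin m × Fin n)
  (row-cell : ∀ r c → row (cell r c) ≡ r) (col-cell : ∀ r c → col (cell r c) ≡ c)
  (cell-η : ∀ v → cell (row v) (col v) ≡ v)
  (adjacent : ∀ {u v} → row u ≡ row v ⊎ col u ≡ col v → u ≢ v → Graph._~_ (K m □ K n) u v)
  (M : Pairing (K m □ K n)) where

  open PairingPartner (K m □ K n) M
  open Grid partner partner-involutive partner-≢ row col cell row-cell col-cell cell-η public

  cycleThrough : 3 ≤ R * C → ClosedRoute allCells →
    Σ (HamiltonianCycle K⟨ K m □ K n ⟩) λ H →
      (∀ {u v} → PerfectMatching.Edge M u v → HamiltonianCycle.Edge H u v) ×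
      (∀ {u v} → HamiltonianCycle.Edge H u v → ¬ PerfectMatching.Edge M u v → Graph._~_ (K m □ K n) u v)
  cycleThrough 3≤RC (u , w , w≈u , path α , ρ) =
    HamiltonianClosing.hamiltonianCycle (K m □ K n) M Aligned (Sum.map sym sym) adjacent α w≈u
      (subst (3 ≤_) (≡.trans (sym length-allCells) (sym (↭-length ρ))) 3≤RC)
      (Unique-resp-↭ (↭-sym ρ) allCells-unique) (λ v → ∈-resp-↭ (↭-sym ρ) (∈-allCells v))

module _ {m n : ℕ} where
  open Graph (K m □ K n) using (_~_)

  same-column⇒~ : {u v : Fin m × Fin n} → proj₁ u ≡ proj₁ v → u ≢ v → u ~ v
  same-column⇒~ eq u≢v = inj₁ (eq , λ eq′ → u≢v (cong₂ _,_ eq eq′))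

  same-row⇒~ : {u v : Fin m × Fin n} → proj₂ u ≡ proj₂ v → u ≢ v → u ~ v
  same-row⇒~ eq u≢v = inj₂ ((λ eq′ → u≢v (cong₂ _,_ eq′ eq)) , eq)

rook-PH : ∀ m n → Even m → 4 ≤ m → 1 ≤ n → PHProperty (K m □ K n)
rook-PH m n@(suc _) 2∣m 4≤m 1≤n M = cycleThrough 3≤nm (hamiltonian 2∣m 4≤m zero)
  where
  -- The second coordinate serves as the row, so that each row has `m` cells, an even number not
  -- below four.
  open OrientedRook m n proj₂ proj₁ (λ r c → c , r) (λ _ _ → refl) (λ _ _ → refl) (λ _ → refl)
    Sum.[ same-row⇒~ , same-column⇒~ ] M
  3≤nm : 3 ≤ n * m
  3≤nm = ℕ.≤-trans (ℕ.<⇒≤ 4≤m) (ℕ.m≤n*m m n)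

prism-PH : ∀ n → Even n → 1 ≤ n → PHProperty (K 2 □ K n)
prism-PH 1 2∣1 _ = contradiction 2∣1 (from-no (2 ∣? 1))
prism-PH 3 2∣3 _ = contradiction 2∣3 (from-no (2 ∣? 3))
-- Two columns are too few for routes, but at most two closed rows remain. Within `Fin 2`, changing
-- the column twice means taking the opposite of the opposite.
prism-PH 2 2∣2 _ M = cycleThrough (s≤s (s≤s (s≤s z≤n)))
  (hamiltonian₂ 2∣2 ℕ.≤-refl zero zero λ c≢b d≢c →
    ≡.trans (opposite-flips (d≢c ∘ sym))
      (≡.trans (cong opposite (opposite-flips (c≢b ∘ sym))) (Fin.opposite-involutive _)))
  where
  open OrientedRook 2 2 proj₁ proj₂ _,_ (λ _ _ → refl) (λ _ _ → refl) (λ _ → refl)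
    Sum.[ same-column⇒~ , same-row⇒~ ] M
prism-PH n@(suc (suc (suc (suc _)))) 2∣n _ M = cycleThrough 3≤2n (hamiltonian 2∣n 4≤n zero)
  where
  -- Here the first coordinate serves as the row: two rows of `n` cells, where `n` is even.
  open OrientedRook 2 n proj₁ proj₂ _,_ (λ _ _ → refl) (λ _ _ → refl) (λ _ → refl)
    Sum.[ same-column⇒~ , same-row⇒~ ] M
  4≤n : 4 ≤ n
  4≤n = s≤s (s≤s (s≤s (s≤s z≤n)))
  3≤2n : 3 ≤ 2 * n
  3≤2n = ℕ.≤-trans (ℕ.<⇒≤ 4≤n) (ℕ.m≤n*m n 2)

theorem2p1 : (m₁ m₂ : ℕ) → 1 ≤ m₁ → Even m₁ → 1 ≤ m₂ →
    (¬ PHProperty (K m₁ □ K m₂)) ⇔ (m₁ ≡ 2 × Odd m₂)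
theorem2p1 m₁ m₂ 1≤m₁ 2∣m₁ 1≤m₂ = mk⇔ (only-if m₁ 2∣m₁ 1≤m₁) λ { (refl , odd) → prism-¬PH m₂ odd }
  where
  only-if : ∀ m → Even m → 1 ≤ m → ¬ PHProperty (K m □ K m₂) → m ≡ 2 × Odd m₂
  only-if 1 2∣1 _ _ = contradiction 2∣1 (from-no (2 ∣? 1))
  -- `Odd` is a negation: if `m₂` were even, `prism-PH` would contradict `¬ph`.
  only-if 2 _ _ ¬ph = refl , λ 2∣m₂ → ¬ph (prism-PH m₂ 2∣m₂ 1≤m₂)
  only-if 3 2∣3 _ _ = contradiction 2∣3 (from-no (2 ∣? 3))
  only-if m@(suc (suc (suc (suc _)))) 2∣m _ ¬ph =
    contradiction (rook-PH m m₂ 2∣m (s≤s (s≤s (s≤s (s≤s z≤n)))) 1≤m₂) ¬ph
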